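{- Let $G$ be a 2-graph. Then there is a finite sequence of edge refinements, starting from $G$, whose result is an Eulerian graph, i.e. a graph in which every vertex has even degree.
   Context: All graphs are finite simple graphs. For a vertex $x$ of a graph $G$, the unit sphere $S(x)$ is the subgraph of $G$ induced by the neighbors of $x$. A 2-graph is a finite simple graph in which every unit sphere $S(x)$ is a cyclic graph $C_n$ with $n \geq 4$ vertices. An edge refinement of a graph $G=(V,E)$ at an edge $(a,b)\in E$ produces the graph with vertex set $V\cup\{c\}$ ($c$ a new vertex) and edge set $(E\setminus\{(a,b)\})\cup\{(a,c),(c,b)\}\cup\{(c,u) : u \in S(a)\cap S(b)\}$. A sequence of edge refinements means each step is an edge refinement of the graph produced by the previous step (edge refinement of a 2-graph is again a 2-graph). -}

module Defs where

open import Data.Nat using (ℕ; zero; suc; _≤_)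
open import Data.Nat.Divisibility using (_∣_)
open import Data.Fin using (Fin; zero; suc; _≟_)
open import Data.Fin.Properties using () 
open import Data.Bool using (Bool; true; false; _∧_; _∨_; not)
open import Data.List using (List; length; filter; allFin)
open import Data.Product using (Σ; ∃; _×_; _,_)
open import Data.Sum using (_⊎_)
open import Relation.Nullary using (¬_)
open import Relation.Nullary.Decidable using (⌊_⌋)
open import Relation.Binary.PropositionalEquality using (_≡_)
open import Function.Bundles using (_⤖_; _⇔_; Bijection)

record Graph : Set where
  constructor mkGraph
  field
    size : ℕ
    adj  : Fin size → Fin size → Bool
open Graph public

IsSimple : Graph → Set
IsSimple G = (∀ x y → adj G x y ≡ adj G y x) × (∀ x → adj G x x ≡ false)

succMod : ∀ {m} → Fin m → Fin m
succMod {suc m} i with Data.Fin.toℕ i Data.Nat.≟ m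
... | Relation.Nullary.yes _ = zero
... | Relation.Nullary.no ¬p = Data.Fin.fromℕ< (Data.Nat.s≤s (Data.Nat.Properties.≤∧≢⇒< (Data.Fin.Properties.toℕ≤pred[n] i) ¬p))
  where import Data.Nat.Properties

CycAdj : ∀ {m} → Fin m → Fin m → Set
CycAdj i j = (j ≡ succMod i) ⊎ (i ≡ succMod j)

Nbr : (G : Graph) → Fin (size G) → Set
Nbr G x = Σ (Fin (size G)) λ y → adj G x y ≡ true

SphereIsCycle : (G : Graph) → Fin (size G) → Set
SphereIsCycle G x =
  Σ ℕ λ m → (4 ≤ m) × Σ (Fin m ⤖ Nbr G x) λ f →
    ∀ i j → (adj G (Σ.proj₁ (Bijection.to f i)) (Σ.proj₁ (Bijection.to f j)) ≡ true) ⇔ CycAdj i j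
  where open Data.Product

Is2Graph : Graph → Set
Is2Graph G = IsSimple G × (∀ x → SphereIsCycle G x)

-- edge refinement at the edge (a,b): the new vertex c is `zero`, an old vertex u
-- becomes `suc u`.  Edge (a,b) is removed, c is joined to a, b and to S(a) ∩ S(b).
refineAdj : (G : Graph) (a b : Fin (size G)) → Fin (suc (size G)) → Fin (suc (size G)) → Bool
refineAdj G a b zero    zero    = false
refineAdj G a b zero    (suc v) = ⌊ v ≟ a ⌋ ∨ ⌊ v ≟ b ⌋ ∨ (adj G a v ∧ adj G b v)
refineAdj G a b (suc u) zero    = ⌊ u ≟ a ⌋ ∨ ⌊ u ≟ b ⌋ ∨ (adj G a u ∧ adj G b u)
refineAdj G a b (suc u) (suc v) =
  adj G u v ∧ not ((⌊ u ≟ a ⌋ ∧ ⌊ v ≟ b ⌋) ∨ (⌊ u ≟ b ⌋ ∧ ⌊ v ≟ a ⌋))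

refine : (G : Graph) → Fin (size G) → Fin (size G) → Graph
refine G a b = mkGraph (suc (size G)) (refineAdj G a b)

data RefSeq : Graph → Graph → Set where
  done : ∀ {G} → RefSeq G G
  step : ∀ {G H} (a b : Fin (size G)) → adj G a b ≡ true →
         RefSeq (refine G a b) H → RefSeq G H

degree : (G : Graph) → Fin (size G) → ℕ
degree G x = length (filter (λ y → adj G x y Data.Bool.≟ true) (allFin (size G)))

Eulerian : Graph → Set
Eulerian G = ∀ x → 2 ∣ degree G x

{-# OPTIONS --safe #-}
-- Colour the vertices of G with 0.  First refine every edge joining two
-- vertices of colour 0, giving the new vertices colour 1; then refine every
-- edge joining two vertices of colour 1, giving the new vertices colour 2.
-- Throughout, every triangle contains a vertex of colour 0; hence the vertices
-- opposite to an edge of colour 1-1 have colour 0, so that the vertices of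
-- colour 2 only get neighbours of other colours, and the result is properly
-- 3-coloured.  Then every unit sphere is properly 2-coloured, and as every edge
-- lies in exactly two triangles, counting the edges of the sphere from both
-- colour classes shows that these have the same size: every degree is even.
module Submission where

open import Defs
open import Axiom.UniquenessOfIdentityProofs.WithK using (uip)
open import Data.Bool using (Bool; true; false; _∧_; _∨_; not)
open import Data.Bool.Properties using (∨-comm; ∧-comm; ∧-zeroʳ; ∧-identityʳ; ∧-conicalˡ; ∧-conicalʳ)
open import Data.Fin using (Fin; zero; suc; toℕ; fromℕ; inject₁; punchIn; _≟_)
open import Data.Fin.Patterns using (0F; 1F; 2F)
open import Data.Fin.Properties
  using (toℕ-injective; toℕ-fromℕ; toℕ-fromℕ<; toℕ-inject₁; toℕ-inject₁-≢; toℕ≤pred[n];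
         suc-injective; 0≢1+n; punchInᵢ≢i)
open import Data.Fin.Relation.Unary.Top using (view; ‵fromℕ; ‵inject₁)
open import Data.List using (length; filter; tabulate)
open import Data.Nat using (ℕ; zero; suc; _+_; _*_; _≤_; _<_; z≤n; s≤s)
open import Data.Nat.Divisibility using (_∣_; divides)
open import Data.Nat.GeneralisedArithmetic using (iterate)
open import Data.Nat.Properties
  using (+-*-semiring; +-0-commutativeMonoid; +-suc; +-assoc; +-comm; +-identityʳ; +-cancelˡ-≡;
         *-distribʳ-+; *-cancelˡ-≡; *-comm; ≤⇒≯; ≤∧≢⇒<; m≤m+n; ≤-trans)
open import Data.Product using (Σ; ∃; _×_; _,_; proj₁; proj₂)
open import Data.Sum using (_⊎_; inj₁; inj₂; [_,_]′) renaming (map to ⊎-map; swap to ⊎-swap)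
open import Data.Vec using (Vec; []; _∷_)
import Data.Vec as Vec
open import Data.Vec.Functional using () renaming (_∷_ to _◂_)
open import Data.Vec.Membership.Propositional using (_∈_)
open import Data.Vec.Membership.Propositional.Properties using (∈-map⁺; ∈-allFin⁺; ∈-allPairs⁺)
open import Data.Vec.Relation.Unary.Any using (here; there)
open import Function using (_∘_; id)
open import Function.Bundles using (Bijection; Equivalence)
open import Relation.Binary.PropositionalEquality
  using (_≡_; _≢_; refl; sym; trans; cong; cong₂; subst; module ≡-Reasoning)
open import Relation.Nullary using (¬_; yes; no; contradiction)
open import Relation.Nullary.Decidable using (⌊_⌋; _×-dec_; isYes≗does; dec-true)
open import Algebra.Properties.CommutativeMonoid.Sum +-0-commutativeMonoid
  using (sum; sum-syntax; sum-cong-≗; sum-remove; sum-replicate-zero; ∑-distrib-+; ∑-comm)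
open import Algebra.Properties.Semiring.Sum +-*-semiring using (*-distribˡ-sum)

private
  variable
    G : Graph
    m n : ℕ

-- The successor on a cycle

-- Congruence modulo `n` with the multiple made explicit: `q` is 1 when the successor wraps round to
-- `zero`, and 0 otherwise.
succMod-toℕ : (i : Fin n) → ∃ λ q → suc (toℕ i) ≡ toℕ (succMod i) + q * n
succMod-toℕ {suc n} i with toℕ i Data.Nat.≟ n
... | yes i≡n = 1 , cong suc (trans i≡n (sym (+-identityʳ n)))
... | no i≢n  = 0 , sym (trans (+-identityʳ _) (toℕ-fromℕ< (s≤s (≤∧≢⇒< (toℕ≤pred[n] i) i≢n))))

iterate-succMod-toℕ : ∀ k (i : Fin n) → ∃ λ q → toℕ i + k ≡ toℕ (iterate succMod i k) + q * n
iterate-succMod-toℕ zero i = 0 , refl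
iterate-succMod-toℕ {n} (suc k) i
  with succMod-toℕ i | iterate-succMod-toℕ k (succMod i)
... | q , eq | r , eq′ = r + q , (begin
  toℕ i + suc k                      ≡⟨ +-suc (toℕ i) k ⟩
  suc (toℕ i) + k                    ≡⟨ cong (_+ k) eq ⟩
  (toℕ (succMod i) + q * n) + k      ≡⟨ +-assoc (toℕ (succMod i)) _ k ⟩
  toℕ (succMod i) + (q * n + k)      ≡⟨ cong (toℕ (succMod i) +_) (+-comm (q * n) k) ⟩
  toℕ (succMod i) + (k + q * n)      ≡⟨ +-assoc (toℕ (succMod i)) k _ ⟨
  (toℕ (succMod i) + k) + q * n      ≡⟨ cong (_+ q * n) eq′ ⟩
  (t + r * n) + q * n                ≡⟨ +-assoc t _ _ ⟩
  t + (r * n + q * n)                ≡⟨ cong (t +_) (*-distribʳ-+ n r q) ⟨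
  t + (r + q) * n                    ∎)
  where
  open ≡-Reasoning
  t = toℕ (iterate succMod (succMod i) k)

-- Returning to `i` after `suc k` steps would make `suc k` a positive multiple of `n`, hence at
-- least `n`.
iterate-succMod-≢ : ∀ k → suc k < n → (i : Fin n) → iterate succMod i (suc k) ≢ i
iterate-succMod-≢ {n} k k<n i period
  with iterate-succMod-toℕ (suc k) i
... | q , eq with q | +-cancelˡ-≡ (toℕ i) _ _ (trans eq (cong (λ j → toℕ j + q * n) period))
... | suc r | eq′ = ≤⇒≯ (subst (n ≤_) (sym eq′) (m≤m+n n (r * n))) k<n

succMod-fromℕ : ∀ n → succMod (fromℕ n) ≡ zero
succMod-fromℕ n with toℕ (fromℕ n) Data.Nat.≟ n
... | yes _ = refl
... | no ≢n = contradiction (toℕ-fromℕ n) ≢n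

succMod-inject₁ : (i : Fin n) → succMod (inject₁ i) ≡ suc i
succMod-inject₁ {n} i with toℕ (inject₁ i) Data.Nat.≟ n
... | yes ≡n = contradiction (sym ≡n) (toℕ-inject₁-≢ i)
... | no ≢n  = toℕ-injective
  (trans (toℕ-fromℕ< (s≤s (≤∧≢⇒< (toℕ≤pred[n] (inject₁ i)) ≢n))) (cong suc (toℕ-inject₁ i)))

succMod-injective : {i j : Fin n} → succMod i ≡ succMod j → i ≡ j
succMod-injective {suc n} {i} {j} eq with view i | view j
... | ‵fromℕ     | ‵fromℕ     = refl
... | ‵fromℕ     | ‵inject₁ j = contradiction (trans (sym (succMod-fromℕ n)) (trans eq (succMod-inject₁ j))) 0≢1+n
... | ‵inject₁ i | ‵fromℕ     = contradiction (trans (sym (succMod-fromℕ n)) (trans (sym eq) (succMod-inject₁ i))) 0≢1+n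
... | ‵inject₁ i | ‵inject₁ j =
  cong inject₁ (suc-injective (trans (sym (succMod-inject₁ i)) (trans eq (succMod-inject₁ j))))

succMod-surjective : (i : Fin n) → ∃ λ j → succMod j ≡ i
succMod-surjective {suc n} zero    = fromℕ n , succMod-fromℕ n
succMod-surjective {suc n} (suc i) = inject₁ i , succMod-inject₁ i

-- Graphs in which every edge lies in exactly two triangles

_⊢_~_ : (G : Graph) → Fin (size G) → Fin (size G) → Set
G ⊢ x ~ y = adj G x y ≡ true

infix 4 _⊢_~_

~-sym : IsSimple G → ∀ {x y} → G ⊢ x ~ y → G ⊢ y ~ x
~-sym (symm , _) {x} {y} x~y = trans (symm y x) x~y

~-irrefl : IsSimple G → ∀ {x} → ¬ G ⊢ x ~ x
~-irrefl (_ , irr) {x} x~x with trans (sym x~x) (irr x)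
... | ()

~⇒≢ : IsSimple G → ∀ {x y} → G ⊢ x ~ y → x ≢ y
~⇒≢ simple x~y refl = ~-irrefl simple x~y

-- Excluding an edge uv (that is, a K₄) is what makes "every edge lies in
-- exactly two triangles" survive a refinement.
record Opposite (G : Graph) (a b u v : Fin (size G)) : Set where
  field
    a~u  : G ⊢ a ~ u
    b~u  : G ⊢ b ~ u
    a~v  : G ⊢ a ~ v
    b~v  : G ⊢ b ~ v
    u≢v  : u ≢ v
    u≁v  : ¬ G ⊢ u ~ v
    only : ∀ {w} → G ⊢ a ~ w → G ⊢ b ~ w → w ≡ u ⊎ w ≡ v

-- Equivalently, every unit sphere is a disjoint union of cycles of length at least 4. This local
-- form can be checked edge by edge after a refinement, with no bijection onto a cycle to rebuild.
record IsSurface (G : Graph) : Set where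
  field
    simple   : IsSimple G
    opposite : ∀ {a b} → G ⊢ a ~ b → ∃ λ u → ∃ λ v → Opposite G a b u v

Opposite-swapˡ : ∀ {a b u v} → Opposite G a b u v → Opposite G b a u v
Opposite-swapˡ o = record
  { a~u = b~u ; b~u = a~u ; a~v = b~v ; b~v = a~v ; u≢v = u≢v ; u≁v = u≁v
  ; only = λ b~w a~w → only a~w b~w }
  where open Opposite o

Opposite-swapʳ : IsSimple G → ∀ {a b u v} → Opposite G a b u v → Opposite G a b v u
Opposite-swapʳ simple o = record
  { a~u = a~v ; b~u = b~v ; a~v = a~u ; b~v = b~u ; u≢v = u≢v ∘ sym ; u≁v = u≁v ∘ ~-sym simple
  ; only = λ a~w b~w → ⊎-swap (only a~w b~w) }
  where open Opposite o

-- Adjacency proofs are equalities, hence unique. This lets injectivity of the bijection onto a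
-- sphere be used on bare vertices.
Nbr-≡ : ∀ {x} {y z : Nbr G x} → proj₁ y ≡ proj₁ z → y ≡ z
Nbr-≡ {y = y , _} refl = cong (y ,_) (uip _ _)

-- On the cycle around `a`, the vertex `b` sits at a position `sp`; its predecessor `p` and
-- successor `s²p` give the two vertices opposite to the edge.
2-graph⇒surface : Is2Graph G → IsSurface G
2-graph⇒surface {G} (simple , spheres) = record { simple = simple ; opposite = opp }
  where
  opp : ∀ {a b} → G ⊢ a ~ b → ∃ λ u → ∃ λ v → Opposite G a b u v
  opp {a} {b} a~b with spheres a
  ... | m , 4≤m , f , cyc with Bijection.surjective f (b , a~b)
  ...   | i , fi≡b with succMod-surjective i
  ...     | p , refl = vertex s²p , vertex p , record
    { a~u = proj₂ (to s²p)
    ; b~u = subst (λ w → G ⊢ w ~ vertex s²p) vertex-sp (Equivalence.from (cyc sp s²p) (inj₁ refl))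
    ; a~v = proj₂ (to p)
    ; b~v = subst (λ w → G ⊢ w ~ vertex p) vertex-sp (Equivalence.from (cyc sp p) (inj₂ refl))
    ; u≢v = iterate-succMod-≢ 1 (≤-trans (s≤s (s≤s (s≤s z≤n))) 4≤m) p ∘ Bijection.injective f ∘ Nbr-≡ {G}
    -- Adjacency on the cycle would mean returning to `p` after three steps or after one; three is
    -- where length at least 4 enters.
    ; u≁v = λ u~v → [ iterate-succMod-≢ 2 4≤m p ∘ sym
                    , iterate-succMod-≢ 0 (≤-trans (s≤s (s≤s z≤n)) 4≤m) p ∘ succMod-injective
                    ]′ (Equivalence.to (cyc s²p p) u~v)
    ; only = only
    }
    where
    open Bijection f using (to)
    vertex : Fin m → Fin (size G)
    vertex j = proj₁ (to j)
    sp s²p : Fin m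
    sp = succMod p
    s²p = succMod sp
    vertex-sp : vertex sp ≡ b
    vertex-sp = cong proj₁ (fi≡b refl)
    only : ∀ {w} → G ⊢ a ~ w → G ⊢ b ~ w → w ≡ vertex s²p ⊎ w ≡ vertex p
    only {w} a~w b~w with Bijection.surjective f (w , a~w)
    ... | j , fj≡w with cong proj₁ (fj≡w refl)
    ...   | refl = ⊎-map (cong vertex) (cong vertex ∘ sym ∘ succMod-injective)
                     (Equivalence.to (cyc sp j) (subst (λ v → G ⊢ v ~ vertex j) (sym vertex-sp) b~w))

-- Edge refinement

module Refinement {G : Graph} (surface : IsSurface G) {a b : Fin (size G)} (a~b : G ⊢ a ~ b) where
  open IsSurface surface

  R : Graph
  R = refine G a b

  data Apex (w : Fin (size G)) : Set where
    at-a   : w ≡ a → Apex w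
    at-b   : w ≡ b → Apex w
    common : G ⊢ a ~ w → G ⊢ b ~ w → Apex w

  -- The refined edge read in either direction, so that the later lemmas treat both of its ends at
  -- once.
  data Ends (x y : Fin (size G)) : Set where
    ab : x ≡ a → y ≡ b → Ends x y
    ba : x ≡ b → y ≡ a → Ends x y

  apex⁻ : ∀ {w} → R ⊢ zero ~ suc w → Apex w
  apex⁻ {w} 0~w with w ≟ a
  ... | yes w≡a = at-a w≡a
  ... | no _ with w ≟ b
  ...   | yes w≡b = at-b w≡b
  ...   | no _ with adj G a w in a~w | adj G b w in b~w
  ...     | true | true = common a~w b~w

  apex⁺ : ∀ {w} → Apex w → R ⊢ zero ~ suc w
  apex⁺ {w} p with w ≟ a
  ... | yes _ = refl
  ... | no w≢a with w ≟ b | p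
  ...   | yes _  | _ = refl
  ...   | no _   | at-a w≡a = contradiction w≡a w≢a
  ...   | no w≢b | at-b w≡b = contradiction w≡b w≢b
  ...   | no _   | common a~w b~w = cong₂ _∧_ a~w b~w

  old⁻ : ∀ {x y} → R ⊢ suc x ~ suc y → G ⊢ x ~ y × ¬ Ends x y
  old⁻ {x} {y} x~y with adj G x y | x ≟ a | y ≟ b | x ≟ b | y ≟ a
  ... | true | no x≢a | _      | no x≢b | _      = refl , λ { (ab e _) → x≢a e ; (ba e _) → x≢b e }
  ... | true | no x≢a | _      | yes _  | no y≢a = refl , λ { (ab e _) → x≢a e ; (ba _ e) → y≢a e }
  ... | true | yes _  | no y≢b | no x≢b | _      = refl , λ { (ab _ e) → y≢b e ; (ba e _) → x≢b e }
  ... | true | yes _  | no y≢b | yes _  | no y≢a = refl , λ { (ab _ e) → y≢b e ; (ba _ e) → y≢a e }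

  old⁺ : ∀ {x y} → G ⊢ x ~ y → ¬ Ends x y → R ⊢ suc x ~ suc y
  old⁺ {x} {y} x~y ¬ends with adj G x y | x ≟ a | y ≟ b | x ≟ b | y ≟ a
  ... | true | no _  | _     | no _  | _     = refl
  ... | true | no _  | _     | yes _ | no _  = refl
  ... | true | yes _ | no _  | no _  | _     = refl
  ... | true | yes _ | no _  | yes _ | no _  = refl
  ... | true | yes p | yes q | _     | _     = contradiction (ab p q) ¬ends
  ... | true | _     | _     | yes p | yes q = contradiction (ba p q) ¬ends

  R-simple : IsSimple R
  R-simple = symm , irr
    where
    symm : ∀ x y → adj R x y ≡ adj R y x
    symm zero    zero    = refl
    symm zero    (suc y) = refl
    symm (suc x) zero    = refl
    symm (suc x) (suc y) = cong₂ _∧_ (proj₁ simple x y) (cong not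
      (trans (∨-comm (⌊ x ≟ a ⌋ ∧ ⌊ y ≟ b ⌋) _)
             (cong₂ _∨_ (∧-comm ⌊ x ≟ b ⌋ _) (∧-comm ⌊ x ≟ a ⌋ _))))
    irr : ∀ x → adj R x x ≡ false
    irr zero    = refl
    irr (suc x) rewrite proj₂ simple x = refl

  R-sym : ∀ x y → R ⊢ x ~ y → R ⊢ y ~ x
  R-sym x y = ~-sym R-simple {x} {y}

  Ends-~ : ∀ {x y} → Ends x y → G ⊢ x ~ y
  Ends-~ (ab refl refl) = a~b
  Ends-~ (ba refl refl) = ~-sym simple a~b

  Ends-apex : ∀ {x y} → Ends x y → Apex x
  Ends-apex (ab x≡a _) = at-a x≡a
  Ends-apex (ba x≡b _) = at-b x≡b

  Ends-unique : ∀ {x y z} → Ends x y → Ends x z → y ≡ z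
  Ends-unique (ab _ refl) (ab _ refl) = refl
  Ends-unique (ba _ refl) (ba _ refl) = refl
  Ends-unique (ab refl _) (ba a≡b _)  = contradiction a≡b (~⇒≢ simple a~b)
  Ends-unique (ba refl _) (ab b≡a _)  = contradiction (sym b≡a) (~⇒≢ simple a~b)

  Ends-common : ∀ {x y w} → Ends x y → G ⊢ x ~ w → G ⊢ y ~ w → Apex w
  Ends-common (ab refl refl) x~w y~w = common x~w y~w
  Ends-common (ba refl refl) x~w y~w = common y~w x~w

  Apex-split : ∀ {x y w} → Ends x y → Apex w → w ≡ x ⊎ w ≡ y ⊎ G ⊢ y ~ w
  Apex-split (ab refl refl) (at-a e)         = inj₁ e
  Apex-split (ab refl refl) (at-b e)         = inj₂ (inj₁ e)
  Apex-split (ab refl refl) (common _ b~w)   = inj₂ (inj₂ b~w)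
  Apex-split (ba refl refl) (at-a e)         = inj₂ (inj₁ e)
  Apex-split (ba refl refl) (at-b e)         = inj₁ e
  Apex-split (ba refl refl) (common a~w _)   = inj₂ (inj₂ a~w)

  -- There are no loops, so a vertex adjacent to both ends of the refined edge is neither of them.
  common⇒¬Ends : ∀ {x y p z} → Ends x p → G ⊢ x ~ y → G ⊢ p ~ y → ¬ Ends y z
  common⇒¬Ends (ab refl refl) x~y p~y (ab refl _) = ~-irrefl simple x~y
  common⇒¬Ends (ab refl refl) x~y p~y (ba refl _) = ~-irrefl simple p~y
  common⇒¬Ends (ba refl refl) x~y p~y (ab refl _) = ~-irrefl simple p~y
  common⇒¬Ends (ba refl refl) x~y p~y (ba refl _) = ~-irrefl simple x~y

  -- A triangle of R through the new vertex lies in a triangle of G through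
  -- the refined edge.
  apex-triangle : ∀ {x y} → R ⊢ zero ~ suc x → R ⊢ zero ~ suc y → R ⊢ suc x ~ suc y →
                  (∃ λ p → Ends x p × G ⊢ p ~ y) ⊎ (∃ λ p → Ends y p × G ⊢ p ~ x)
  apex-triangle {x} {y} 0~x 0~y x~′y with old⁻ x~′y
  ... | x~y , ¬ends = cases (apex⁻ 0~x) (apex⁻ 0~y)
    where
    cases : Apex x → Apex y → (∃ λ p → Ends x p × G ⊢ p ~ y) ⊎ (∃ λ p → Ends y p × G ⊢ p ~ x)
    cases (at-a refl)   (at-a refl)   = contradiction x~y (~-irrefl simple)
    cases (at-a x≡a)    (at-b y≡b)    = contradiction (ab x≡a y≡b) ¬ends
    cases (at-b x≡b)    (at-a y≡a)    = contradiction (ba x≡b y≡a) ¬ends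
    cases (at-b refl)   (at-b refl)   = contradiction x~y (~-irrefl simple)
    cases (at-a x≡a)    (common _ q)  = inj₁ (b , ab x≡a refl , q)
    cases (at-b x≡b)    (common q _)  = inj₁ (a , ba x≡b refl , q)
    cases (common _ q)  (at-a y≡a)    = inj₂ (b , ab y≡a refl , q)
    cases (common q _)  (at-b y≡b)    = inj₂ (a , ba y≡b refl , q)
    -- Both vertices now lie opposite to the refined edge, so they coincide or are non-adjacent: the
    -- excluded K₄ rules this case out.
    cases (common p q)  (common r s) with opposite a~b
    ... | u , v , o with Opposite.only o p q | Opposite.only o r s
    ...   | inj₁ refl | inj₁ refl = contradiction x~y (~-irrefl simple)
    ...   | inj₁ refl | inj₂ refl = contradiction x~y (Opposite.u≁v o)
    ...   | inj₂ refl | inj₁ refl = contradiction (~-sym simple x~y) (Opposite.u≁v o)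
    ...   | inj₂ refl | inj₂ refl = contradiction x~y (~-irrefl simple)

  -- The triangle xyp is cut, since xp is the refined edge: the new vertex replaces p.
  opposite-cut : ∀ {x y p q} → Ends x p → Opposite G x y p q → R ⊢ suc x ~ suc y →
                 Opposite R (suc x) (suc y) zero (suc q)
  opposite-cut {x} {y} {p} {q} ends o x~′y = record
    { a~u = R-sym zero (suc x) (apex⁺ (Ends-apex ends))
    ; b~u = R-sym zero (suc y) (apex⁺ (Ends-common ends x~y p~y))
    ; a~v = old⁺ a~v (λ ends′ → u≢v (Ends-unique ends ends′))
    ; b~v = old⁺ b~v (common⇒¬Ends ends x~y p~y)
    ; u≢v = λ ()
    -- A neighbour of the new vertex is `x`, `p` or a neighbour of `p`; for `q` the last would
    -- complete a K₄ in `G`.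
    ; u≁v = λ 0~q → [ (λ q≡x → ~⇒≢ simple a~v (sym q≡x)) , [ u≢v ∘ sym , u≁v ]′ ]′
                      (Apex-split ends (apex⁻ 0~q))
    ; only = only′
    }
    where
    open Opposite o
    x~y = proj₁ (old⁻ x~′y)
    p~y = ~-sym simple b~u
    only′ : ∀ {w} → R ⊢ suc x ~ w → R ⊢ suc y ~ w → w ≡ zero ⊎ w ≡ suc q
    only′ {zero}  _   _   = inj₁ refl
    only′ {suc w} x~w y~w with only (proj₁ (old⁻ x~w)) (proj₁ (old⁻ y~w))
    ... | inj₁ refl = contradiction ends (proj₂ (old⁻ x~w))
    ... | inj₂ refl = inj₂ refl

  -- As a common neighbour of `x` and `y`, the vertex `p` is one of the two opposite vertices, so up
  -- to their order `opposite-cut` applies.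
  opposite-replaced : ∀ {x y p} → Ends x p → G ⊢ p ~ y → R ⊢ suc x ~ suc y →
                  ∃ λ u → ∃ λ v → Opposite R (suc x) (suc y) u v
  opposite-replaced ends p~y x~′y with opposite (proj₁ (old⁻ x~′y))
  ... | u , v , o with Opposite.only o (Ends-~ ends) (~-sym simple p~y)
  ...   | inj₁ refl = _ , _ , opposite-cut ends o x~′y
  ...   | inj₂ refl = _ , _ , opposite-cut ends (Opposite-swapʳ simple o) x~′y

  -- If a triangle of `G` on `x y` contained the refined edge, the new vertex would be adjacent to
  -- both `x` and `y`. Hence both triangles survive and no third one arises.
  opposite-kept : ∀ {x y} → R ⊢ suc x ~ suc y →
                  ¬ (R ⊢ zero ~ suc x × R ⊢ zero ~ suc y) →
                  ∃ λ u → ∃ λ v → Opposite R (suc x) (suc y) u v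
  opposite-kept {x} {y} x~′y ¬apex with opposite (proj₁ (old⁻ x~′y))
  ... | u , v , o = suc u , suc v , record
    { a~u = old⁺ a~u (keepˡ b~u)
    ; b~u = old⁺ b~u (keepʳ a~u)
    ; a~v = old⁺ a~v (keepˡ b~v)
    ; b~v = old⁺ b~v (keepʳ a~v)
    ; u≢v = u≢v ∘ suc-injective
    ; u≁v = u≁v ∘ proj₁ ∘ old⁻
    ; only = only′
    }
    where
    open Opposite o
    x~y = proj₁ (old⁻ x~′y)
    keepˡ : ∀ {w} → G ⊢ y ~ w → ¬ Ends x w
    keepˡ y~w ends = ¬apex
      (apex⁺ (Ends-apex ends) , apex⁺ (Ends-common ends x~y (~-sym simple y~w)))
    keepʳ : ∀ {w} → G ⊢ x ~ w → ¬ Ends y w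
    keepʳ x~w ends = ¬apex
      (apex⁺ (Ends-common ends (~-sym simple x~y) (~-sym simple x~w)) , apex⁺ (Ends-apex ends))
    only′ : ∀ {w} → R ⊢ suc x ~ w → R ⊢ suc y ~ w → w ≡ suc u ⊎ w ≡ suc v
    only′ {zero}  x~0 y~0 =
      contradiction (R-sym (suc x) zero x~0 , R-sym (suc y) zero y~0) ¬apex
    only′ {suc w} x~w y~w = ⊎-map (cong suc) (cong suc) (only (proj₁ (old⁻ x~w)) (proj₁ (old⁻ y~w)))

  -- The sphere of the new vertex is the 4-cycle `a`, `u`, `b`, `v`, with `u` and `v` opposite to
  -- the refined edge: seen from `a` or `b` the answer is `u` and `v`, seen from `u` or `v` it is
  -- `a` and `b`.
  opposite-apex : ∀ {w} → R ⊢ zero ~ suc w → ∃ λ u → ∃ λ v → Opposite R zero (suc w) u v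
  opposite-apex {w} 0~w with opposite a~b
  ... | u , v , o = cases (apex⁻ 0~w)
    where
    open Opposite o
    side : ∀ {p z} → Ends w p → G ⊢ a ~ z → G ⊢ b ~ z → R ⊢ suc w ~ suc z
    side (ab refl _) a~z b~z = old⁺ a~z λ { (ab _ refl) → ~-irrefl simple b~z ; (ba _ refl) → ~-irrefl simple a~z }
    side (ba refl _) a~z b~z = old⁺ b~z λ { (ab _ refl) → ~-irrefl simple b~z ; (ba _ refl) → ~-irrefl simple a~z }
    only-end : ∀ {p z} → Ends w p → R ⊢ zero ~ z → R ⊢ suc w ~ z → z ≡ suc u ⊎ z ≡ suc v
    only-end {p} {suc z} ends 0~z w~z with apex⁻ 0~z | ends
    ... | common a~z b~z | _ = ⊎-map (cong suc) (cong suc) (only a~z b~z)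
    ... | at-a refl | ab refl _ = contradiction w~z (~-irrefl R-simple {suc a})
    ... | at-b refl | ba refl _ = contradiction w~z (~-irrefl R-simple {suc b})
    ... | at-a refl | ba refl refl = contradiction (ba refl refl) (proj₂ (old⁻ w~z))
    ... | at-b refl | ab refl refl = contradiction (ab refl refl) (proj₂ (old⁻ w~z))
    end : ∀ {p} → Ends w p → Opposite R zero (suc w) (suc u) (suc v)
    end ends = record
      { a~u = apex⁺ (common a~u b~u)
      ; b~u = side ends a~u b~u
      ; a~v = apex⁺ (common a~v b~v)
      ; b~v = side ends a~v b~v
      ; u≢v = u≢v ∘ suc-injective
      ; u≁v = u≁v ∘ proj₁ ∘ old⁻
      ; only = only-end ends
      }
    cases : Apex w → ∃ λ u → ∃ λ v → Opposite R zero (suc w) u v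
    cases (at-a w≡a) = _ , _ , end (ab w≡a refl)
    cases (at-b w≡b) = _ , _ , end (ba w≡b refl)
    cases (common a~w b~w) = suc a , suc b , record
      { a~u = apex⁺ (at-a refl)
      ; b~u = old⁺ (~-sym simple a~w) (common⇒¬Ends (ab refl refl) a~w b~w)
      ; a~v = apex⁺ (at-b refl)
      ; b~v = old⁺ (~-sym simple b~w) (common⇒¬Ends (ab refl refl) a~w b~w)
      ; u≢v = ~⇒≢ simple a~b ∘ suc-injective
      ; u≁v = λ a~′b → proj₂ (old⁻ a~′b) (ab refl refl)
      ; only = only′
      }
      where
      only′ : ∀ {z} → R ⊢ zero ~ z → R ⊢ suc w ~ z → z ≡ suc a ⊎ z ≡ suc b
      -- One of `w` and `z` is an end of the refined edge; `w` is adjacent to both ends, so it is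
      -- `z`.
      only′ {suc z} 0~z w~z with apex-triangle {w} {z} 0~w 0~z w~z
      ... | inj₁ (_ , ab refl _ , _) = contradiction a~w (~-irrefl simple)
      ... | inj₁ (_ , ba refl _ , _) = contradiction b~w (~-irrefl simple)
      ... | inj₂ (_ , ab refl _ , _) = inj₁ refl
      ... | inj₂ (_ , ba refl _ , _) = inj₂ refl

  -- Edges between old vertices are sorted by whether the new vertex is adjacent to both ends: if
  -- so, a triangle on the edge was cut; otherwise both triangles survive.
  R-opposite : ∀ {x y} → R ⊢ x ~ y → ∃ λ u → ∃ λ v → Opposite R x y u v
  R-opposite {zero}  {suc y} 0~y = opposite-apex 0~y
  R-opposite {suc x} {zero}  x~0 with opposite-apex {x} x~0
  ... | u , v , o = u , v , Opposite-swapˡ o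
  R-opposite {suc x} {suc y} x~y
    with (adj R zero (suc x) Data.Bool.≟ true) ×-dec (adj R zero (suc y) Data.Bool.≟ true)
  ... | no ¬apex = opposite-kept x~y ¬apex
  ... | yes (0~x , 0~y) with apex-triangle 0~x 0~y x~y
  ...   | inj₁ (_ , ends , p~y) = opposite-replaced ends p~y x~y
  ...   | inj₂ (_ , ends , p~x) with opposite-replaced {y} {x} ends p~x (R-sym (suc x) (suc y) x~y)
  ...     | u , v , o = u , v , Opposite-swapˡ o

  refine-surface : IsSurface R
  refine-surface = record { simple = R-simple ; opposite = R-opposite }

-- Colourings

Colouring : Graph → Set
Colouring G = Fin (size G) → Fin 3

Proper : (G : Graph) → Colouring G → Fin 3 → Set
Proper G col k = ∀ x y → G ⊢ x ~ y → col x ≡ k → col y ≢ k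

-- The invariant of both rounds. No round clears colour 2, so its properness must hold throughout;
-- `triangle` is what maintains it.
record Coloured (G : Graph) (col : Colouring G) : Set where
  field
    surface  : IsSurface G
    proper₂  : Proper G col 2F
    triangle : ∀ {x y z} → G ⊢ x ~ y → G ⊢ x ~ z → G ⊢ y ~ z → col x ≡ 0F ⊎ col y ≡ 0F ⊎ col z ≡ 0F

-- Taking `k` in `Fin 2` handles both rounds together: the ends have colour `inject₁ k`, the new
-- vertex gets the next colour `suc k`.
module RefineColoured {G : Graph} {col : Colouring G} (coloured : Coloured G col) (k : Fin 2)
  {a b : Fin (size G)} (a~b : G ⊢ a ~ b) (ka : col a ≡ inject₁ k) (kb : col b ≡ inject₁ k) where
  open Coloured coloured
  open IsSurface surface using (simple)
  open Refinement surface a~b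

  col′ : Colouring R
  col′ = suc k ◂ col

  refine-proper : ∀ {j} → j ≢ suc k → Proper G col j → Proper R col′ j
  refine-proper j≢ proper zero    _       _   k≡j _   = j≢ (sym k≡j)
  refine-proper j≢ proper (suc x) zero    _   _   k≡j = j≢ (sym k≡j)
  refine-proper j≢ proper (suc x) (suc y) x~y = proper x y (proj₁ (old⁻ x~y))

  Ends-col : ∀ {x y} → Ends x y → col y ≡ col x
  Ends-col (ab refl refl) = trans kb (sym ka)
  Ends-col (ba refl refl) = trans ka (sym kb)

  -- The equation selects the second round, where `a` and `b` have colour 1; the triangle `a b w`
  -- then forces colour 0 on a common neighbour `w`.
  new-edge : ∀ {w} → suc k ≡ 2F → R ⊢ zero ~ suc w → col w ≢ 2F
  new-edge {w} refl 0~w w2 with apex⁻ {w} 0~w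
  ... | at-a refl = contradiction (trans (sym ka) w2) λ ()
  ... | at-b refl = contradiction (trans (sym kb) w2) λ ()
  ... | common a~w b~w with triangle a~b a~w b~w
  ...   | inj₁ a0        = contradiction (trans (sym ka) a0) λ ()
  ...   | inj₂ (inj₁ b0) = contradiction (trans (sym kb) b0) λ ()
  ...   | inj₂ (inj₂ w0) = contradiction (trans (sym w2) w0) λ ()

  new-proper₂ : Proper R col′ 2F
  new-proper₂ zero    (suc y) 0~y k2 y2 = new-edge k2 0~y y2
  new-proper₂ (suc x) zero    x~0 x2 k2 = new-edge k2 (R-sym (suc x) zero x~0) x2
  new-proper₂ (suc x) (suc y) x~y = proper₂ x y (proj₁ (old⁻ x~y))

  -- The triangle `x y p` of `G` has a vertex of colour 0, and if that vertex is `p`, then `x` has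
  -- colour 0 too, since the ends share a colour.
  cut-triangle : ∀ {x y p} → Ends x p → G ⊢ p ~ y → G ⊢ x ~ y → col x ≡ 0F ⊎ col y ≡ 0F
  cut-triangle ends p~y x~y with triangle x~y (Ends-~ ends) (~-sym simple p~y)
  ... | inj₁ x0        = inj₁ x0
  ... | inj₂ (inj₁ y0) = inj₂ y0
  ... | inj₂ (inj₂ p0) = inj₁ (trans (sym (Ends-col ends)) p0)

  -- The new vertex has colour 1 or 2, so a triangle through it has to find colour 0 on the opposite
  -- edge.
  new-triangle : ∀ {x y} → R ⊢ zero ~ suc x → R ⊢ zero ~ suc y → R ⊢ suc x ~ suc y →
                 col x ≡ 0F ⊎ col y ≡ 0F
  new-triangle 0~x 0~y x~y with apex-triangle 0~x 0~y x~y
  ... | inj₁ (_ , ends , p~y) = cut-triangle ends p~y (proj₁ (old⁻ x~y))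
  ... | inj₂ (_ , ends , p~x) = ⊎-swap (cut-triangle ends p~x (~-sym simple (proj₁ (old⁻ x~y))))

  refine-triangle : ∀ x y z → R ⊢ x ~ y → R ⊢ x ~ z → R ⊢ y ~ z →
                    col′ x ≡ 0F ⊎ col′ y ≡ 0F ⊎ col′ z ≡ 0F
  refine-triangle zero (suc y) (suc z) 0~y 0~z y~z = inj₂ (new-triangle 0~y 0~z y~z)
  refine-triangle (suc x) zero (suc z) x~0 x~z 0~z =
    [ inj₁ , inj₂ ∘ inj₂ ]′ (new-triangle (R-sym (suc x) zero x~0) 0~z x~z)
  refine-triangle (suc x) (suc y) zero x~y x~0 y~0 =
    [ inj₁ , inj₂ ∘ inj₁ ]′ (new-triangle (R-sym (suc x) zero x~0) (R-sym (suc y) zero y~0) x~y)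
  refine-triangle (suc x) (suc y) (suc z) x~y x~z y~z =
    triangle (proj₁ (old⁻ x~y)) (proj₁ (old⁻ x~z)) (proj₁ (old⁻ y~z))

  refine-coloured : Coloured R col′
  refine-coloured = record
    { surface  = refine-surface
    ; proper₂  = new-proper₂
    ; triangle = λ {x} {y} {z} → refine-triangle x y z
    }

-- Removing all monochromatic edges of one colour

Covers : (G : Graph) → Colouring G → Fin 3 → Vec (Fin (size G) × Fin (size G)) m → Set
Covers G col k es = ∀ x y → G ⊢ x ~ y → col x ≡ k → col y ≡ k → (x , y) ∈ es

-- The field `preserves` carries properness of colour 0 through the round that clears colour 1.
record Cleared (k : Fin 2) (G : Graph) (col : Colouring G) : Set where
  field
    {H}       : Graph
    {col-H}   : Colouring H
    refines   : RefSeq G H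
    coloured  : Coloured H col-H
    proper    : Proper H col-H (inject₁ k)
    preserves : ∀ {j} → j ≢ suc k → Proper G col j → Proper H col-H j

suc≢inject₁ : (k : Fin n) → suc k ≢ inject₁ k
suc≢inject₁ (suc k) = suc≢inject₁ k ∘ suc-injective

-- Refining re-indexes the remaining edges, so the recursion is on the length
-- of the vector rather than on its structure.
clear : ∀ k {col} → Coloured G col → (es : Vec _ m) → Covers G col (inject₁ k) es → Cleared k G col
clear k coloured [] covers = record
  { refines   = done
  ; coloured  = coloured
  ; proper    = λ x y x~y kx ky → contradiction (covers x y x~y kx ky) λ ()
  ; preserves = λ _ → id
  }
clear {G} k {col} coloured ((a , b) ∷ es) covers
  with (adj G a b Data.Bool.≟ true) ×-dec (col a ≟ inject₁ k) ×-dec (col b ≟ inject₁ k)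
-- The vector may list pairs that are not, or no longer, monochromatic edges, such as the reverse of
-- an edge already refined.
... | no ¬mono = clear k coloured es covers′
  where
  covers′ : Covers G col (inject₁ k) es
  covers′ x y x~y kx ky with covers x y x~y kx ky
  ... | here refl  = contradiction (x~y , kx , ky) ¬mono
  ... | there xy∈  = xy∈
... | yes (a~b , ka , kb) = record
  { refines   = step a b a~b C.refines
  ; coloured  = C.coloured
  ; proper    = C.proper
  ; preserves = λ j≢ proper → C.preserves j≢ (refine-proper j≢ proper)
  }
  where
  open Refinement (Coloured.surface coloured) a~b
  open RefineColoured coloured k a~b ka kb
  suc₂ : Fin (size G) × Fin (size G) → Fin (size R) × Fin (size R)
  suc₂ (x , y) = suc x , suc y
  covers′ : Covers R col′ (inject₁ k) (Vec.map suc₂ es)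
  -- The new vertex has the next colour, so it lies on no edge still to be refined.
  covers′ zero    _       _   kc _  = contradiction kc (suc≢inject₁ k)
  covers′ (suc x) zero    _   _  kc = contradiction kc (suc≢inject₁ k)
  covers′ (suc x) (suc y) x~y kx ky with old⁻ x~y
  ... | x~y , ¬ends with covers x y x~y kx ky
  ...   | here refl = contradiction (ab refl refl) ¬ends
  ...   | there xy∈ = ∈-map⁺ suc₂ xy∈
  module C = Cleared (clear k refine-coloured (Vec.map suc₂ es) covers′)

clear-all : ∀ k {col} → Coloured G col → Cleared k G col
clear-all {G} k coloured = clear k coloured (Vec.allPairs (Vec.allFin (size G)) (Vec.allFin (size G)))
  λ x y _ _ _ → ∈-allPairs⁺ (∈-allFin⁺ x) (∈-allFin⁺ y)

RefSeq-trans : ∀ {H K} → RefSeq G H → RefSeq H K → RefSeq G K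
RefSeq-trans done            s = s
RefSeq-trans (step a b a~b r) s = step a b a~b (RefSeq-trans r s)

-- Degrees

𝟙 : Bool → ℕ
𝟙 true  = 1
𝟙 false = 0

-- Stated for an arbitrary `f` rather than for `allFin`, so that the induction can pass to
-- `f ∘ suc`.
length-filter-tabulate : ∀ {A : Set} (p : A → Bool) {n} (f : Fin n → A) →
  length (filter (λ y → p y Data.Bool.≟ true) (tabulate f)) ≡ ∑[ i < n ] 𝟙 (p (f i))
length-filter-tabulate p {zero}  f = refl
length-filter-tabulate p {suc n} f with p (f zero)
... | true  = cong suc (length-filter-tabulate p (f ∘ suc))
... | false = length-filter-tabulate p (f ∘ suc)

∑-zero : ∀ {f : Fin n → ℕ} → (∀ i → f i ≡ 0) → sum f ≡ 0
∑-zero {n} f≡0 = trans (sum-cong-≗ f≡0) (sum-replicate-zero n)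

∑-single : ∀ {f : Fin n → Bool} u → f u ≡ true → (∀ w → f w ≡ true → w ≡ u) → ∑[ i < n ] 𝟙 (f i) ≡ 1
∑-single {suc n} {f} u fu only rewrite sum-remove {i = u} (𝟙 ∘ f) | fu =
  cong suc (∑-zero λ i → zero-at (punchIn u i) (punchInᵢ≢i u i))
  where
  zero-at : ∀ w → w ≢ u → 𝟙 (f w) ≡ 0
  zero-at w w≢u with f w in fw
  ... | true  = contradiction (only w fw) w≢u
  ... | false = refl

∑-pair : ∀ {f : Fin n → Bool} u v → u ≢ v → f u ≡ true → f v ≡ true →
         (∀ w → f w ≡ true → w ≡ u ⊎ w ≡ v) → ∑[ i < n ] 𝟙 (f i) ≡ 2
∑-pair {n} {f} u v u≢v fu fv only = begin
  ∑[ i < n ] 𝟙 (f i)                                              ≡⟨ sum-cong-≗ split ⟩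
  ∑[ i < n ] (𝟙 ⌊ i ≟ u ⌋ + 𝟙 ⌊ i ≟ v ⌋)                          ≡⟨ ∑-distrib-+ (λ i → 𝟙 ⌊ i ≟ u ⌋) _ ⟩
  ∑[ i < n ] 𝟙 ⌊ i ≟ u ⌋ + ∑[ i < n ] 𝟙 ⌊ i ≟ v ⌋                 ≡⟨ cong₂ _+_ (∑-≟ u) (∑-≟ v) ⟩
  2                                                               ∎
  where
  open ≡-Reasoning
  ∑-≟ : ∀ u → ∑[ i < n ] 𝟙 ⌊ i ≟ u ⌋ ≡ 1
  ∑-≟ u = ∑-single u (trans (isYes≗does (u ≟ u)) (dec-true (u ≟ u) refl)) sound
    where
    sound : ∀ w → ⌊ w ≟ u ⌋ ≡ true → w ≡ u
    sound w _ with w ≟ u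
    ... | yes w≡u = w≡u
  split : ∀ i → 𝟙 (f i) ≡ 𝟙 ⌊ i ≟ u ⌋ + 𝟙 ⌊ i ≟ v ⌋
  split i with i ≟ u | i ≟ v
  ... | yes refl | yes u≡v  = contradiction u≡v u≢v
  ... | yes refl | no _     = cong 𝟙 fu
  ... | no _     | yes refl = cong 𝟙 fv
  ... | no i≢u   | no i≢v with f i in fi
  ...   | false = refl
  ...   | true  = contradiction (only i fi) [ i≢u , i≢v ]′

-- Double counting in a bipartite unit sphere

module Degree {G : Graph} (surface : IsSurface G) (x : Fin (size G)) (side : Fin (size G) → Bool)
  (bipartite : ∀ {y z} → G ⊢ x ~ y → G ⊢ x ~ z → G ⊢ y ~ z → side z ≡ not (side y)) where
  open IsSurface surface
  open ≡-Reasoning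

  class : Bool → Fin (size G) → Bool
  class s y = adj G x y ∧ ⌊ side y Data.Bool.≟ s ⌋

  -- The edges of the sphere of `x`, each directed from class `true` to class `false` and therefore
  -- counted once.
  crossing : Fin (size G) → Fin (size G) → Bool
  crossing y z = adj G y z ∧ class true y ∧ class false z

  class⁺ : ∀ {y s} → G ⊢ x ~ y → side y ≡ s → class s y ≡ true
  class⁺ {y} x~y refl rewrite x~y with side y
  ... | true  = refl
  ... | false = refl

  class⁻ : ∀ {y s} → class s y ≡ true → G ⊢ x ~ y × side y ≡ s
  class⁻ {y} {s} c with adj G x y | side y Data.Bool.≟ s
  ... | true | yes e = refl , e

  crossing⁺ : ∀ {y z} → G ⊢ y ~ z → class true y ≡ true → class false z ≡ true → crossing y z ≡ true
  crossing⁺ p q r = cong₂ _∧_ p (cong₂ _∧_ q r)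

  crossing⁻ : ∀ {y z} → crossing y z ≡ true → G ⊢ y ~ z × class true y ≡ true × class false z ≡ true
  crossing⁻ {y} {z} c with adj G y z | class true y | class false z
  ... | true | true | true = refl , refl , refl

  -- Inside the sphere, the neighbours of `y` are the two vertices opposite to the edge from `x` to
  -- `y`, and bipartiteness puts both in the other class.
  row : ∀ y → ∑[ z < size G ] 𝟙 (crossing y z) ≡ 2 * 𝟙 (class true y)
  row y with class true y in cy
  ... | false = ∑-zero zero-at
    where
    zero-at : ∀ z → 𝟙 (adj G y z ∧ false) ≡ 0
    zero-at z = cong 𝟙 (∧-zeroʳ (adj G y z))
  ... | true with class⁻ {y} cy
  ...   | x~y , sy with opposite x~y
  ...     | u , v , o = ∑-pair u v u≢v (cross a~u b~u) (cross a~v b~v) sound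
    where
    open Opposite o
    cross : ∀ {z} → G ⊢ x ~ z → G ⊢ y ~ z → adj G y z ∧ true ∧ class false z ≡ true
    cross {z} x~z y~z = cong₂ _∧_ y~z (class⁺ {z} x~z (trans (bipartite x~y x~z y~z) (cong not sy)))
    sound : ∀ w → adj G y w ∧ true ∧ class false w ≡ true → w ≡ u ⊎ w ≡ v
    sound w c = only (proj₁ (class⁻ {w} {false} (∧-conicalʳ (adj G y w) _ c))) (∧-conicalˡ (adj G y w) _ c)

  column : ∀ z → ∑[ y < size G ] 𝟙 (crossing y z) ≡ 2 * 𝟙 (class false z)
  column z with class false z in cz
  ... | false = ∑-zero zero-at
    where
    zero-at : ∀ y → 𝟙 (adj G y z ∧ class true y ∧ false) ≡ 0
    zero-at y = cong 𝟙 (trans (cong (adj G y z ∧_) (∧-zeroʳ (class true y))) (∧-zeroʳ (adj G y z)))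
  ... | true with class⁻ {z} cz
  ...   | x~z , sz with opposite x~z
  ...     | u , v , o = ∑-pair u v u≢v (cross a~u b~u) (cross a~v b~v) sound
    where
    open Opposite o
    cross : ∀ {y} → G ⊢ x ~ y → G ⊢ z ~ y → adj G y z ∧ class true y ∧ true ≡ true
    cross {y} x~y z~y = cong₂ _∧_ (~-sym simple z~y)
      (trans (∧-identityʳ _) (class⁺ {y} x~y (trans (bipartite x~z x~y z~y) (cong not sz))))
    sound : ∀ w → adj G w z ∧ class true w ∧ true ≡ true → w ≡ u ⊎ w ≡ v
    sound w c = only
      (proj₁ (class⁻ {w} {true} (∧-conicalˡ (class true w) _ (∧-conicalʳ (adj G w z) _ c))))
      (~-sym simple (∧-conicalˡ (adj G w z) _ c))

  classes-equinumerous : ∑[ y < size G ] 𝟙 (class true y) ≡ ∑[ y < size G ] 𝟙 (class false y)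
  classes-equinumerous = *-cancelˡ-≡ _ _ 2 (begin
    2 * ∑[ y < size G ] 𝟙 (class true y)                     ≡⟨ *-distribˡ-sum 2 (𝟙 ∘ class true) ⟩
    ∑[ y < size G ] (2 * 𝟙 (class true y))                   ≡⟨ sum-cong-≗ row ⟨
    ∑[ y < size G ] ∑[ z < size G ] 𝟙 (crossing y z)         ≡⟨ ∑-comm (λ y z → 𝟙 (crossing y z)) ⟩
    ∑[ z < size G ] ∑[ y < size G ] 𝟙 (crossing y z)         ≡⟨ sum-cong-≗ column ⟩
    ∑[ z < size G ] (2 * 𝟙 (class false z))                  ≡⟨ *-distribˡ-sum 2 (𝟙 ∘ class false) ⟨
    2 * ∑[ z < size G ] 𝟙 (class false z)                    ∎)

  even-degree : 2 ∣ degree G x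
  even-degree = divides (∑[ y < size G ] 𝟙 (class true y)) (begin
    degree G x                                                     ≡⟨ length-filter-tabulate (adj G x) id ⟩
    ∑[ y < size G ] 𝟙 (adj G x y)                                  ≡⟨ sum-cong-≗ split ⟩
    ∑[ y < size G ] (𝟙 (class true y) + 𝟙 (class false y))         ≡⟨ ∑-distrib-+ (𝟙 ∘ class true) _ ⟩
    t + ∑[ y < size G ] 𝟙 (class false y)                          ≡⟨ cong (t +_) classes-equinumerous ⟨
    t + t                                                          ≡⟨ cong (t +_) (+-identityʳ t) ⟨
    2 * t                                                          ≡⟨ *-comm 2 t ⟩
    t * 2                                                          ∎)
    where
    t = ∑[ y < size G ] 𝟙 (class true y)
    split : ∀ y → 𝟙 (adj G x y) ≡ 𝟙 (class true y) + 𝟙 (class false y)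
    split y with adj G x y | side y
    ... | false | _     = refl
    ... | true  | true  = refl
    ... | true  | false = refl

-- Properly 3-coloured surfaces

other : Fin 3 → Fin 3
other 0F = 1F
other 1F = 2F
other 2F = 0F

-- Here `j` and `k` are the two colours different from `i`, and exactly one of them is `other i`. So
-- testing for `other i` splits the sphere of a vertex of colour `i` into two classes.
three-colours : ∀ i j k → i ≢ j → i ≢ k → j ≢ k → ⌊ k ≟ other i ⌋ ≡ not ⌊ j ≟ other i ⌋
three-colours 0F 1F 2F _ _ _ = refl
three-colours 0F 2F 1F _ _ _ = refl
three-colours 1F 0F 2F _ _ _ = refl
three-colours 1F 2F 0F _ _ _ = refl
three-colours 2F 0F 1F _ _ _ = refl
three-colours 2F 1F 0F _ _ _ = refl
three-colours 0F 0F _ p _ _ = contradiction refl p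
three-colours 1F 1F _ p _ _ = contradiction refl p
three-colours 2F 2F _ p _ _ = contradiction refl p
three-colours 0F _ 0F _ p _ = contradiction refl p
three-colours 1F _ 1F _ p _ = contradiction refl p
three-colours 2F _ 2F _ p _ = contradiction refl p
three-colours _ 0F 0F _ _ p = contradiction refl p
three-colours _ 1F 1F _ _ p = contradiction refl p
three-colours _ 2F 2F _ _ p = contradiction refl p

3-colourable⇒Eulerian : ∀ {col} → IsSurface G → (∀ k → Proper G col k) → Eulerian G
3-colourable⇒Eulerian {G} {col} surface proper x =
  Degree.even-degree surface x (λ y → ⌊ col y ≟ other (col x) ⌋)
    λ {y} {z} x~y x~z y~z → three-colours (col x) (col y) (col z) (distinct x~y) (distinct x~z) (distinct y~z)
  where
  distinct : ∀ {y z} → G ⊢ y ~ z → col y ≢ col z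
  distinct y~z = proper _ _ _ y~z refl ∘ sym

theoremI : (G : Graph) → Is2Graph G → Σ Graph (λ H → RefSeq G H × Eulerian H)
theoremI G is2 = C₁.H , RefSeq-trans C₀.refines C₁.refines , 3-colourable⇒Eulerian C₁.surface proper
  where
  initial : Coloured G (λ _ → 0F)
  initial = record { surface = 2-graph⇒surface is2 ; proper₂ = λ _ _ _ () ; triangle = λ _ _ _ → inj₁ refl }
  module C₀ = Cleared (clear-all 0F initial)
  module C₁ where
    open Cleared (clear-all 1F C₀.coloured) public
    open Coloured coloured public
  proper : ∀ k → Proper C₁.H C₁.col-H k
  -- Colour 0 stays proper because the second round adds only vertices of colour 2.
  proper 0F = C₁.preserves (λ ()) C₀.proper
  proper 1F = C₁.proper
  proper 2F = C₁.proper₂
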